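{- Let $m,n\ge2$. If $f\in\operatorname{vert}(\Diamond_m,\Diamond_n)$ and $f(0)$ lies in the interior of $\Diamond_n$, then $f(0)=0$.
   Context: For convex polytopes $P,Q$, $\operatorname{Hom}(P,Q)$ is the set of maps $P\to Q$ that are restrictions of affine maps $\operatorname{Aff}(P)\to\operatorname{Aff}(Q)$; it is a convex polytope in the affine space of affine maps $\operatorname{Aff}(P)\to\operatorname{Aff}(Q)$, and $\operatorname{vert}(P,Q)$ denotes its set of vertices. $\Diamond_n=\operatorname{conv}(\pm e_1,\ldots,\pm e_n)\subset\mathbb{R}^n$ is the $n$-dimensional crosspolytope. -}

module Defs where

open import Level using (Level; _⊔_) renaming (suc to lsuc)
open import Algebra.Bundles using (CommutativeRing)
open import Algebra.Apartness.Bundles using (HeytingField)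
import Algebra.Apartness.Properties.HeytingCommutativeRing as HeytingProperties
import Algebra.Definitions.RawMonoid as RawMonoid
import Algebra.Properties.Ring as RingProperties
import Algebra.Properties.Semiring.Sum as Sum
open import Data.Bool.Base using (if_then_else_)
open import Data.Fin.Base using (zero; suc; splitAt; _↑ˡ_; _↑ʳ_)
open import Data.Fin.Properties using (_≟_)
open import Data.Nat.Base as ℕ using (ℕ)
open import Data.Product.Base using (∃; _×_; _,_; proj₁; proj₂)
open import Data.Sum.Base using (_⊎_; inj₁; inj₂)
open import Data.Vec.Functional using (Vector; _++_; map; replicate; _∷_)
open import Data.Vec.Functional.Properties using (lookup-++ˡ; lookup-++ʳ)
import Data.Vec.Functional.Relation.Binary.Equality.Setoid as VectorEquality
open import Function.Base using (_∘_)
open import Relation.Binary.Core using (Rel)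
import Relation.Binary.PropositionalEquality.Core as ≡
import Relation.Binary.Reasoning.Setoid as ≈-Reasoning
open import Relation.Binary.Structures using (IsStrictPartialOrder)
open import Relation.Nullary.Decidable.Core using (does)
open import Relation.Nullary.Negation.Core using (¬_; contradiction)

-- The real numbers, axiomatised as a Cauchy-complete Archimedean ordered
-- field.  Classically this determines ℝ up to isomorphism.  The order is not
-- assumed decidable, so the constructive Cauchy reals are a model as well.
record RealNumbers (c ℓ₁ ℓ₂ : Level) : Set (lsuc (c ⊔ ℓ₁ ⊔ ℓ₂)) where
  infix 4 _<_ _≤_
  field
    heytingField : HeytingField c ℓ₁ ℓ₂

  open HeytingField heytingField public

  commutativeRing : CommutativeRing c ℓ₁
  commutativeRing = record { isCommutativeRing = isCommutativeRing }

  open CommutativeRing commutativeRing public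
    using (ring; semiring; +-rawMonoid)
  open RawMonoid +-rawMonoid public using () renaming (_×_ to _·_)

  field
    _<_                  : Rel Carrier ℓ₂
    isStrictPartialOrder : IsStrictPartialOrder _≈_ _<_
    #⇒<⊎>                : ∀ {x y} → x # y → x < y ⊎ y < x
    <⇒#                  : ∀ {x y} → x < y → x # y
    +-monoˡ-<            : ∀ {x y} z → x < y → x + z < y + z
    *-pos                : ∀ {x y} → 0# < x → 0# < y → 0# < x * y
    archimedean          : ∀ x → ∃ λ n → x < n · 1#

  _≤_ : Rel Carrier ℓ₂
  x ≤ y = ¬ (y < x)

  -- The absolute value is left implicit: i and j may be interchanged.
  IsCauchy : (ℕ → Carrier) → Set (c ⊔ ℓ₂)
  IsCauchy s = ∀ ε → 0# < ε →
    ∃ λ N → ∀ i j → N ℕ.≤ i → N ℕ.≤ j → s i - s j < ε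

  _ConvergesTo_ : (ℕ → Carrier) → Carrier → Set (c ⊔ ℓ₂)
  s ConvergesTo l = ∀ ε → 0# < ε →
    ∃ λ N → ∀ i → N ℕ.≤ i → s i - l < ε × l - s i < ε

  field
    complete : ∀ s → IsCauchy s → ∃ λ l → s ConvergesTo l

module Polytopes {c ℓ₁ ℓ₂ : Level} (ℝ : RealNumbers c ℓ₁ ℓ₂) where

  open RealNumbers ℝ public
  open VectorEquality setoid public using (_≋_)
  open Sum semiring

  infix 4 _∈_ _∈Aff_ _∈Interior_

  Space : ℕ → Set c
  Space d = Vector Carrier d

  𝟎 : ∀ {d} → Space d
  𝟎 {d} = replicate d 0#

  combination : ∀ {k d} → Vector Carrier k → Vector (Space d) k → Space d
  combination w p i = sum (λ j → w j * p j i)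

  -- A convex polytope is the convex hull of finitely many points; the
  -- generators need not be its vertices.
  record Polytope (d : ℕ) : Set c where
    constructor conv
    field
      {size}     : ℕ
      generators : Vector (Space d) size

  open Polytope public

  _∈Aff_ : ∀ {d} → Space d → Polytope d → Set (c ⊔ ℓ₁)
  x ∈Aff P = ∃ λ w → sum w ≈ 1# × x ≋ combination w (generators P)

  _∈_ : ∀ {d} → Space d → Polytope d → Set (c ⊔ ℓ₁ ⊔ ℓ₂)
  x ∈ P = ∃ λ w → (∀ j → 0# ≤ w j) × sum w ≈ 1# × x ≋ combination w (generators P)

  _∈Interior_ : ∀ {d} → Space d → Polytope d → Set (c ⊔ ℓ₁ ⊔ ℓ₂)
  x ∈Interior P = ∃ λ ε → 0# < ε ×
    (∀ y → sum (λ i → (y i - x i) * (y i - x i)) < ε * ε → y ∈ P)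

  Point : ∀ {d} → Polytope d → Set (c ⊔ ℓ₁ ⊔ ℓ₂)
  Point P = ∃ λ x → x ∈ P

  Aff : ∀ {d} → Polytope d → Set (c ⊔ ℓ₁)
  Aff P = ∃ λ x → x ∈Aff P

  Point⇒Aff : ∀ {d} {P : Polytope d} → Point P → Aff P
  Point⇒Aff (x , w , _ , ∑w≈1 , x≋wP) = x , w , ∑w≈1 , x≋wP

  -- An affine map is one preserving affine combinations.  The case k = 1 says
  -- that it depends only on coordinates, not on the proof of membership.
  IsAffine : ∀ {d d′} {P : Polytope d} {Q : Polytope d′} →
             (Aff P → Aff Q) → Set (c ⊔ ℓ₁)
  IsAffine {P = P} F =
    ∀ k (w : Vector Carrier k) (p : Vector (Aff P) k) (x : Aff P) →
    sum w ≈ 1# →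
    proj₁ x ≋ combination w (proj₁ ∘ p) →
    proj₁ (F x) ≋ combination w (proj₁ ∘ F ∘ p)

  record Hom {d d′} (P : Polytope d) (Q : Polytope d′) : Set (c ⊔ ℓ₁ ⊔ ℓ₂) where
    field
      apply        : Point P → Point Q
      extension    : Aff P → Aff Q
      isAffine     : IsAffine {P = P} {Q = Q} extension
      isRestricted : ∀ x → proj₁ (apply x) ≋ proj₁ (extension (Point⇒Aff {P = P} x))

    _⟨_⟩ : Point P → Space d′
    _⟨_⟩ x = proj₁ (apply x)

  open Hom public using (_⟨_⟩)

  -- The vertices of the polytope Hom P Q are its extreme points.  Its elements
  -- are compared and combined pointwise on P; since P spans Aff P, this agrees
  -- with the structure of the affine space of affine maps Aff P → Aff Q.
  IsVertex : ∀ {d d′} {P : Polytope d} {Q : Polytope d′} →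
             Hom P Q → Set (c ⊔ ℓ₁ ⊔ ℓ₂)
  IsVertex {P = P} {Q = Q} f =
    ∀ (g h : Hom P Q) t → 0# < t → t < 1# →
    (∀ x i → (f ⟨ x ⟩) i ≈ (1# - t) * (g ⟨ x ⟩) i + t * (h ⟨ x ⟩) i) →
    (∀ x → f ⟨ x ⟩ ≋ g ⟨ x ⟩) × (∀ x → f ⟨ x ⟩ ≋ h ⟨ x ⟩)

  e : ∀ {n} → Vector (Space n) n
  e i j = if does (i ≟ j) then 1# else 0#

  ◇ : ∀ n → Polytope n
  ◇ n = conv (e ++ map (map (-_)) e)

  open RingProperties ring using (-‿distribˡ-*; -‿distribʳ-*; -‿involutive)
  open HeytingProperties heytingCommutativeRing using (1#0; x-0≈x)
  open IsStrictPartialOrder isStrictPartialOrder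
    using (irrefl; <-respˡ-≈; <-respʳ-≈) renaming (trans to <-trans)

  0<1 : 0# < 1#
  0<1 with #⇒<⊎> 1#0
  ... | inj₂ p = p
  ... | inj₁ 1<0 = contradiction (<-trans 0<-1*-1 1<0) (irrefl refl)
    where
    0<-1 : 0# < - 1#
    0<-1 = <-respˡ-≈ (-‿inverseʳ 1#) (<-respʳ-≈ (+-identityˡ _) (+-monoˡ-< (- 1#) 1<0))

    -1*-1≈1 : - 1# * - 1# ≈ 1#
    -1*-1≈1 = trans (sym (-‿distribˡ-* 1# (- 1#)))
                    (trans (-‿cong (*-identityˡ (- 1#))) (-‿involutive 1#))

    0<-1*-1 : 0# < 1#
    0<-1*-1 = <-respʳ-≈ -1*-1≈1 (*-pos 0<-1 0<-1)

  half : ∃ λ h → h + h ≈ 1# × 0# ≤ h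
  half = h , h+h≈1 , λ h<0 → irrefl refl (<-trans 0<1 (1<0 h<0))
    where
    0<2 : 0# < 1# + 1#
    0<2 = <-trans 0<1 (<-respˡ-≈ (+-identityˡ 1#) (+-monoˡ-< 1# 0<1))

    inverse = #⇒invertible (#-sym (<⇒# 0<2))
    h = proj₁ inverse

    h+h≈1 : h + h ≈ 1#
    h+h≈1 = begin
      h + h                  ≈⟨ +-cong (*-identityʳ h) (*-identityʳ h) ⟨
      h * 1# + h * 1#        ≈⟨ distribˡ h 1# 1# ⟨
      h * (1# + 1#)          ≈⟨ *-congˡ (x-0≈x _) ⟨
      h * ((1# + 1#) - 0#)   ≈⟨ proj₁ (proj₂ inverse) ⟩
      1#                     ∎
      where open ≈-Reasoning setoid

    1<0 : h < 0# → 1# < 0#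
    1<0 h<0 = <-trans
      (<-respˡ-≈ h+h≈1 (<-respʳ-≈ (+-identityˡ h) (+-monoˡ-< h h<0))) h<0

  sum-split : ∀ m {n} (g : Vector Carrier (m ℕ.+ n)) →
              sum g ≈ sum (λ i → g (i ↑ˡ n)) + sum (λ i → g (m ↑ʳ i))
  sum-split ℕ.zero    g = sym (+-identityˡ _)
  sum-split (ℕ.suc m) g =
    trans (+-congˡ (sum-split m (g ∘ suc))) (sym (+-assoc _ _ _))

  origin∈◇ : ∀ {n} → 1 ℕ.≤ n → 𝟎 ∈ ◇ n
  origin∈◇ {ℕ.suc n} _ = v ++ v , 0≤w , ∑w≈1 , 0≋wP
    where
    open ≈-Reasoning setoid
    N = ℕ.suc n

    v : Vector Carrier N
    v = proj₁ half ∷ replicate n 0#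

    0≤v : ∀ i → 0# ≤ v i
    0≤v zero    = proj₂ (proj₂ half)
    0≤v (suc _) = irrefl refl

    0≤w : ∀ j → 0# ≤ (v ++ v) j
    0≤w j with splitAt N j
    ... | inj₁ i = 0≤v i
    ... | inj₂ i = 0≤v i

    ∑v≈½ : sum v ≈ proj₁ half
    ∑v≈½ = trans (+-congˡ (sum-replicate-zero n)) (+-identityʳ _)

    ∑w≈1 : sum (v ++ v) ≈ 1#
    ∑w≈1 = begin
      sum (v ++ v)               ≈⟨ sum-split N (v ++ v) ⟩
      _                          ≈⟨ +-cong (reflexive (sum-cong-≗ (lookup-++ˡ v v)))
                                           (reflexive (sum-cong-≗ (lookup-++ʳ v v))) ⟩
      sum v + sum v              ≈⟨ +-cong ∑v≈½ ∑v≈½ ⟩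
      proj₁ half + proj₁ half    ≈⟨ proj₁ (proj₂ half) ⟩
      1#                         ∎

    -e : Vector (Space N) N
    -e = map (map (-_)) e

    0≋wP : 𝟎 ≋ combination (v ++ v) (e ++ -e)
    0≋wP i = sym (begin
      combination (v ++ v) (e ++ -e) i
        ≈⟨ sum-split N (λ j → (v ++ v) j * (e ++ -e) j i) ⟩
      _
        ≈⟨ +-cong
             (reflexive (sum-cong-≗ λ a → ≡.cong₂ (λ r x → r * x i) (lookup-++ˡ v v a) (lookup-++ˡ e -e a)))
             (reflexive (sum-cong-≗ λ a → ≡.cong₂ (λ r x → r * x i) (lookup-++ʳ v v a) (lookup-++ʳ e -e a))) ⟩
      sum (λ a → v a * e a i) + sum (λ a → v a * - e a i)
        ≈⟨ ∑-distrib-+ (λ a → v a * e a i) (λ a → v a * - e a i) ⟨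
      sum (λ a → v a * e a i + v a * - e a i)
        ≈⟨ sum-cong-≋ (λ a → trans (+-congˡ (sym (-‿distribʳ-* (v a) (e a i))))
                                   (-‿inverseʳ _)) ⟩
      sum (replicate N 0#)
        ≈⟨ sum-replicate-zero N ⟩
      0# ∎)

  origin : ∀ {n} → 1 ℕ.≤ n → Point (◇ n)
  origin 1≤n = 𝟎 , origin∈◇ 1≤n

{-# OPTIONS --safe #-}

-- Let b = f(0), u = f(eⱼ), v = f(−eⱼ), so u + v = 2b.  If ‖b‖₁ < 1, then some
-- coordinate carries both positive and negative weight among u and v, and this
-- yields q ∈ ◇ₙ for which (u + tq)/(1 − t) and (v − tq)/(1 − t) stay in ◇ₙ for
-- all small t > 0.  Take a t that works for every j, and let L be the linear map
-- eⱼ ↦ −qⱼ.  Then f = (1 − t) g + t L with g and L in Hom(◇ₘ, ◇ₙ), so a vertex f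
-- equals L and f(0) = 0.  Equality of reals is stable under double negation, so
-- the undecidable case distinctions are made below ¬ ¬.
module Submission where

open import Defs
open import Data.Nat.Base using (ℕ) renaming (_≤_ to _≤ℕ_)
open import Data.Nat.Properties using (<⇒≤)
open import Algebra.Bundles using (CommutativeRing)
import Algebra.Properties.Ring as RingProperties
import Algebra.Properties.Semiring.Sum as Summation
import Algebra.Solver.Ring.NaturalCoefficients.Default as Solver
open import Data.Fin.Base using (Fin; zero; suc; splitAt; join; _↑ˡ_; _↑ʳ_)
open import Data.Fin.Properties using (_≟_; join-splitAt; sequence)
open import Data.Nat.Base using (zero; suc)
import Data.Nat.Base as ℕ
open import Data.Product.Base using (∃; _×_; _,_; proj₁; proj₂)
open import Data.Sum.Base as Sum using (_⊎_; inj₁; inj₂; [_,_]; [_,_]′)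
open import Data.Vec.Functional using (Vector; _++_; _∷_; []; map)
open import Data.Vec.Functional.Properties using (lookup-++ˡ; lookup-++ʳ)
open import Effect.Monad using (RawMonad)
open import Function.Base using (_∘_; id)
open import Level using (_⊔_)
import Relation.Binary.PropositionalEquality.Core as ≡
open import Relation.Binary.Structures using (IsStrictPartialOrder)
import Relation.Binary.Reasoning.Setoid as ≈-Reasoning
open import Relation.Nullary.Decidable.Core using (yes; no; ¬¬-excluded-middle)
open import Relation.Nullary.Negation using (¬_; contradiction; ¬¬-Monad)

-- Choice below `¬ ¬` holds for a finite index set, because `¬ ¬` is an applicative functor and can
-- be pulled out one index at a time.
¬¬-sequence : ∀ {a n} {A : Fin n → Set a} → (∀ i → ¬ ¬ A i) → ¬ ¬ (∀ i → A i)
¬¬-sequence = sequence (RawMonad.rawApplicative ¬¬-Monad)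

-- Matching on `splitAt m i` does not refine `i` itself, so the cases are done on `join`, which
-- computes to the two kinds of index, and transported back.
↑-elim : ∀ {a} m {n} (A : Fin (m ℕ.+ n) → Set a) →
         (∀ i → A (i ↑ˡ n)) → (∀ i → A (m ↑ʳ i)) → ∀ i → A i
↑-elim m {n} A left right i =
  ≡.subst A (join-splitAt m n i) (go (splitAt m i))
  where
  go : ∀ j → A (join m n j)
  go (inj₁ j) = left j
  go (inj₂ j) = right j

module Crosspolytopes {c ℓ₁ ℓ₂} (ℝ : RealNumbers c ℓ₁ ℓ₂) where

  open Polytopes ℝ hiding (zero)
  open Summation semiring
  open RingProperties ring
  open IsStrictPartialOrder isStrictPartialOrder
    using (<-respˡ-≈; <-respʳ-≈) renaming (trans to <-trans; irrefl to <-irrefl; asym to <-asym)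
  open CommutativeRing commutativeRing using (commutativeSemiring)
  open Solver commutativeSemiring using (solve; _:=_; _:+_; _:*_)

  private variable
    x y z z′ s t : Carrier

  -- Order and arithmetic of the reals.

  <-resp : x ≈ y → z ≈ z′ → x < z → y < z′
  <-resp x≈y z≈z′ = <-respˡ-≈ x≈y ∘ <-respʳ-≈ z≈z′

  ≤-reflexive : x ≈ y → x ≤ y
  ≤-reflexive x≈y = <-irrefl (sym x≈y)

  -- Stands in for trichotomy. Cotransitivity of `#` yields an apartness; when it points the wrong
  -- way, chaining with `x < y` gives the other alternative.
  <-cotrans : x < y → ∀ z → x < z ⊎ z < y
  <-cotrans x<y z with #-cotrans (<⇒# x<y) z
  ... | inj₁ x#z = [ inj₁ , (λ z<x → inj₂ (<-trans z<x x<y)) ] (#⇒<⊎> x#z)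
  ... | inj₂ z#y = [ inj₂ , (λ y<z → inj₁ (<-trans x<y y<z)) ] (#⇒<⊎> z#y)

  ≤-trans : x ≤ y → y ≤ z → x ≤ z
  ≤-trans x≤y y≤z z<x = [ y≤z , x≤y ] (<-cotrans z<x _)

  ≤-<-trans : x ≤ y → y < z → x < z
  ≤-<-trans x≤y y<z = [ (λ y<x → contradiction y<x x≤y) , id ] (<-cotrans y<z _)

  ≤-antisym : x ≤ y → y ≤ x → x ≈ y
  ≤-antisym x≤y y≤x = proj₁ (tight _ _) λ x#y → [ y≤x , x≤y ] (#⇒<⊎> x#y)

  ≤-resp : x ≈ y → z ≈ z′ → x ≤ z → y ≤ z′
  ≤-resp x≈y z≈z′ x≤z = x≤z ∘ <-resp (sym z≈z′) (sym x≈y)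

  +-monoʳ-< : ∀ x → y < z → x + y < x + z
  +-monoʳ-< x = <-resp (+-comm _ x) (+-comm _ x) ∘ +-monoˡ-< x

  +-cancelʳ-< : ∀ z → x + z < y + z → x < y
  +-cancelʳ-< z = <-resp (//-rightDividesʳ z _) (//-rightDividesʳ z _) ∘ +-monoˡ-< (- z)

  +-cancelˡ-< : ∀ z → z + x < z + y → x < y
  +-cancelˡ-< z = +-cancelʳ-< z ∘ <-resp (+-comm z _) (+-comm z _)

  +-mono-≤ : x ≤ y → z ≤ z′ → x + z ≤ y + z′
  +-mono-≤ {y = y} {z = z} x≤y z≤z′ y+z′<x+z =
    -- The mixed sum `y + z` is compared with both ends: it exceeds the left one or lies below the
    -- right one, and each contradicts one hypothesis.
    [ z≤z′ ∘ +-cancelˡ-< y , x≤y ∘ +-cancelʳ-< z ] (<-cotrans y+z′<x+z (y + z))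

  0≤+ : 0# ≤ x → 0# ≤ y → 0# ≤ x + y
  0≤+ 0≤x 0≤y = ≤-resp (+-identityˡ 0#) refl (+-mono-≤ 0≤x 0≤y)

  0<-⇒< : 0# < y - x → x < y
  0<-⇒< {y} {x} = +-cancelʳ-< (- x) ∘ <-respˡ-≈ (sym (-‿inverseʳ x))

  <⇒0<- : x < y → 0# < y - x
  <⇒0<- {x} = <-respˡ-≈ (-‿inverseʳ x) ∘ +-monoˡ-< (- x)

  ≤⇒0≤- : x ≤ y → 0# ≤ y - x
  ≤⇒0≤- {x} {y} x≤y y-x<0 = x≤y (+-cancelʳ-< (- x) (<-respʳ-≈ (sym (-‿inverseʳ x)) y-x<0))

  -- Nonnegativity is a negation, so both factors may be taken to be positive.
  0≤* : 0# ≤ x → 0# ≤ y → 0# ≤ x * y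
  0≤* {x} {y} 0≤x 0≤y xy<0 = ¬¬0<x λ 0<x → ¬¬0<y λ 0<y → <-asym xy<0 (*-pos 0<x 0<y)
    where
    ¬¬0<x : ¬ ¬ (0# < x)
    ¬¬0<x x≤0 = <-irrefl (trans (*-congʳ (≤-antisym x≤0 0≤x)) (zeroˡ y)) xy<0
    ¬¬0<y : ¬ ¬ (0# < y)
    ¬¬0<y y≤0 = <-irrefl (trans (*-congˡ (≤-antisym y≤0 0≤y)) (zeroʳ x)) xy<0

  0<half : 0# < proj₁ half
  0<half = [ id , +-cancelˡ-< h ∘ <-respˡ-≈ (sym (+-identityʳ h)) ]′
             (<-cotrans (<-respʳ-≈ (sym (proj₁ (proj₂ half))) 0<1) h)
    where h = proj₁ half

  half<1 : proj₁ half < 1#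
  half<1 = <-resp (+-identityʳ _) (proj₁ (proj₂ half)) (+-monoʳ-< _ 0<half)

  square-mono-< : 0# < x → x < y → x * x < y * y
  square-mono-< {x} {y} 0<x x<y = <-trans
    (0<-⇒< (<-respʳ-≈ (x[y-z]≈xy-xz x y x)
      (*-pos 0<x (<⇒0<- x<y))))
    (0<-⇒< (<-respʳ-≈ ([y-z]x≈yx-zx y y x)
      (*-pos (<⇒0<- x<y) (<-trans 0<x x<y))))

  inverse-1-t : t < 1# → ∃ λ s → 0# ≤ s × s * (1# - t) ≈ 1#
  inverse-1-t {t} t<1 with #⇒invertible (#-sym (<⇒# t<1))
  ... | s , s[1-t]≈1 , _ = s , 0≤s , s[1-t]≈1
    where
    0≤s : 0# ≤ s
    -- A negative inverse would make (-s)(1 - t) = -1 a product of positive numbers.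
    0≤s s<0 = <-asym 0<1 (0<-⇒< (<-respʳ-≈ -s[1-t]≈-1
                (*-pos (<⇒0<- s<0) (<⇒0<- t<1))))
      where
      -s[1-t]≈-1 : (0# - s) * (1# - t) ≈ 0# - 1#
      -s[1-t]≈-1 = begin
        (0# - s) * (1# - t)   ≈⟨ *-congʳ (+-identityˡ _) ⟩
        - s * (1# - t)        ≈⟨ -‿distribˡ-* s (1# - t) ⟨
        - (s * (1# - t))      ≈⟨ -‿cong s[1-t]≈1 ⟩
        - 1#                  ≈⟨ +-identityˡ _ ⟨
        0# - 1#               ∎
        where open ≈-Reasoning setoid

  -- The smaller of the two numbers is the bound; deciding which one that is takes excluded middle,
  -- hence the `¬ ¬`.
  common-lower-bound : 0# < x → 0# < y → ¬ ¬ ∃ λ t → 0# < t × t ≤ x × t ≤ y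
  common-lower-bound {x} {y} 0<x 0<y ¬bound = ¬¬-excluded-middle λ where
    (yes x<y) → ¬bound (x , 0<x , ≤-reflexive refl , <-asym x<y)
    (no  y≤x) → ¬bound (y , 0<y , y≤x , ≤-reflexive refl)

  lower-bound : ∀ {n} (x : Vector Carrier n) → (∀ i → 0# < x i) →
                ¬ ¬ ∃ λ t → 0# < t × (∀ i → t ≤ x i)
  lower-bound {zero}  x 0<x ¬bound = ¬bound (1# , 0<1 , λ ())
  lower-bound {suc n} x 0<x ¬bound =
    lower-bound (x ∘ suc) (0<x ∘ suc) λ (t , 0<t , t≤x) →
    common-lower-bound (0<x zero) 0<t λ (r , 0<r , r≤x₀ , r≤t) →
    ¬bound (r , 0<r , λ where
      zero    → r≤x₀
      (suc i) → ≤-trans r≤t (t≤x i))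

  -- Finite sums, combinations and hulls.

  sum-mono-≤ : ∀ {n} {x y : Vector Carrier n} → (∀ i → x i ≤ y i) → sum x ≤ sum y
  sum-mono-≤ {zero}  x≤y = ≤-reflexive refl
  sum-mono-≤ {suc n} x≤y = +-mono-≤ (x≤y zero) (sum-mono-≤ (x≤y ∘ suc))

  sum-zero : ∀ {n} {x : Vector Carrier n} → (∀ i → x i ≈ 0#) → sum x ≈ 0#
  sum-zero {n} x≈0 = trans (sum-cong-≋ x≈0) (sum-replicate-zero n)

  0≤sum : ∀ {n} {x : Vector Carrier n} → (∀ i → 0# ≤ x i) → 0# ≤ sum x
  0≤sum {n} 0≤x = ≤-resp (sum-replicate-zero n) refl (sum-mono-≤ 0≤x)

  -x*y≈x*-y : ∀ x y → - x * y ≈ x * - y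
  -x*y≈x*-y x y = trans (sym (-‿distribˡ-* x y)) (-‿distribʳ-* x y)

  combination-congʳ : ∀ {k d} (w : Vector Carrier k) {p q : Vector (Space d) k} →
                      (∀ j → p j ≋ q j) → combination w p ≋ combination w q
  combination-congʳ w p≋q i = sum-cong-≋ λ j → *-congˡ (p≋q j i)

  combination-congˡ : ∀ {k d} {v w : Vector Carrier k} (p : Vector (Space d) k) →
                      v ≋ w → combination v p ≋ combination w p
  combination-congˡ p v≋w i = sum-cong-≋ λ j → *-congʳ (v≋w j)

  -- Exchange of two sums. It flattens nested combinations, and, with `p` read as the images of the
  -- unit vectors, it says that `combination x p` is linear in `x`.
  combination-assoc : ∀ {k l d} (w : Vector Carrier k) (z : Vector (Vector Carrier l) k)
                      (p : Vector (Space d) l) →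
                      combination (combination w z) p ≋ combination w (λ j → combination (z j) p)
  combination-assoc {k} {l} w z p i = begin
    sum (λ a → sum (λ j → w j * z j a) * p a i)
      ≈⟨ sum-cong-≋ (λ a → *-distribʳ-sum (p a i) (λ j → w j * z j a)) ⟩
    sum (λ a → sum (λ j → w j * z j a * p a i))
      ≈⟨ ∑-comm (λ a j → w j * z j a * p a i) ⟩
    sum (λ j → sum (λ a → w j * z j a * p a i))
      ≈⟨ sum-cong-≋ (λ j → sum-cong-≋ λ a → *-assoc (w j) (z j a) (p a i)) ⟩
    sum (λ j → sum (λ a → w j * (z j a * p a i)))
      ≈⟨ sum-cong-≋ (λ j → *-distribˡ-sum (w j) (λ a → z j a * p a i)) ⟨
    sum (λ j → w j * sum (λ a → z j a * p a i)) ∎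
    where open ≈-Reasoning setoid

  combination-+ : ∀ {k d} (w : Vector Carrier k) (p q : Vector (Space d) k) i →
                  combination w (λ j i → p j i + q j i) i ≈ combination w p i + combination w q i
  combination-+ w p q i = trans
    (sum-cong-≋ λ j → distribˡ (w j) (p j i) (q j i))
    (∑-distrib-+ (λ j → w j * p j i) (λ j → w j * q j i))

  combination-* : ∀ {k d} r (w : Vector Carrier k) (p : Vector (Space d) k) i →
                  combination w (λ j i → r * p j i) i ≈ r * combination w p i
  combination-* r w p i = trans
    (sum-cong-≋ λ j → solve 3 (λ w r p → w :* (r :* p) := r :* (w :* p)) refl (w j) r (p j i))
    (sym (*-distribˡ-sum r (λ j → w j * p j i)))

  sum-combination : ∀ {k l} (w : Vector Carrier k) (z : Vector (Vector Carrier l) k) →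
                    (∀ j → sum (z j) ≈ 1#) → sum (combination w z) ≈ sum w
  sum-combination w z ∑z≈1 = begin
    sum (λ a → sum (λ j → w j * z j a))   ≈⟨ ∑-comm (λ a j → w j * z j a) ⟩
    sum (λ j → sum (λ a → w j * z j a))   ≈⟨ sum-cong-≋ (λ j → *-distribˡ-sum (w j) (z j)) ⟨
    sum (λ j → w j * sum (z j))           ≈⟨ sum-cong-≋ (λ j → trans (*-congˡ (∑z≈1 j)) (*-identityʳ (w j))) ⟩
    sum w                                 ∎
    where open ≈-Reasoning setoid

  ∈-resp-≋ : ∀ {d} {P : Polytope d} {x y} → x ≋ y → x ∈ P → y ∈ P
  ∈-resp-≋ x≋y (w , 0≤w , ∑w≈1 , x≋wP) =
    w , 0≤w , ∑w≈1 , λ i → trans (sym (x≋y i)) (x≋wP i)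

  -- Expanding every `p j` in the generators gives weights that are themselves a combination,
  -- `combination w weights`, of total `sum w`.
  ∈Aff-combination : ∀ {d k} {P : Polytope d} {x} (w : Vector Carrier k) (p : Vector (Space d) k) →
                     (∀ j → p j ∈Aff P) → sum w ≈ 1# → x ≋ combination w p → x ∈Aff P
  ∈Aff-combination {P = P} w p p∈ ∑w≈1 x≋wp =
    combination w weights ,
    trans (sum-combination w weights (λ j → proj₁ (proj₂ (p∈ j)))) ∑w≈1 ,
    λ i → trans (x≋wp i) (trans (combination-congʳ w (λ j → proj₂ (proj₂ (p∈ j))) i)
                                (sym (combination-assoc w weights (generators P) i)))
    where weights = λ j → proj₁ (p∈ j)

  ∈-combination : ∀ {d k} {P : Polytope d} {x} (w : Vector Carrier k) (p : Vector (Space d) k) →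
                  (∀ j → p j ∈ P) → (∀ j → 0# ≤ w j) → sum w ≈ 1# → x ≋ combination w p → x ∈ P
  ∈-combination {P = P} {x = x} w p p∈ 0≤w ∑w≈1 x≋wp =
    proj₁ x∈Aff , (λ a → 0≤sum λ j → 0≤* (0≤w j) (proj₁ (proj₂ (p∈ j)) a)) , proj₂ x∈Aff
    where
    x∈Aff : x ∈Aff P
    x∈Aff = ∈Aff-combination {P = P} w p (λ j → proj₂ (Point⇒Aff {P = P} (p j , p∈ j))) ∑w≈1 x≋wp

  -- Unit vectors and maps given on generators.

  e-sym : ∀ {n} (i j : Fin n) → e i j ≡.≡ e j i
  e-sym zero    zero    = ≡.refl
  e-sym zero    (suc j) = ≡.refl
  e-sym (suc i) zero    = ≡.refl
  e-sym (suc i) (suc j) = e-sym i j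

  sum-e-* : ∀ {n} (k : Fin n) (g : Vector Carrier n) → sum (λ i → e k i * g i) ≈ g k
  sum-e-* zero    g = trans
    (+-cong (*-identityˡ (g zero)) (sum-zero λ i → zeroˡ (g (suc i)))) (+-identityʳ _)
  sum-e-* (suc k) g = trans
    (+-cong (zeroˡ (g zero)) (sum-e-* k (g ∘ suc))) (+-identityˡ _)

  sum-e : ∀ {n} (k : Fin n) → sum (e k) ≈ 1#
  sum-e k = trans (sum-cong-≋ λ i → sym (*-identityʳ (e k i))) (sum-e-* k (λ _ → 1#))

  0≤e : ∀ {n} (k i : Fin n) → 0# ≤ e k i
  0≤e k i with k ≟ i
  ... | yes _ = <-asym 0<1
  ... | no  _ = ≤-reflexive refl

  combination-e : ∀ {n d} (k : Fin n) (p : Vector (Space d) n) → combination (e k) p ≋ p k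
  combination-e k p i = sum-e-* k (λ j → p j i)

  generator : ∀ {d} (P : Polytope d) → Fin (size P) → Point P
  generator P j = generators P j , e j , 0≤e j , sum-e j , λ i → sym (combination-e j (generators P) i)

  -- It suffices to check the generators: a point carries its weights over them, an affine `G` sends
  -- it to the combination of their images with the same weights, and `Q` is convex.
  affineHom : ∀ {d d′} {P : Polytope d} {Q : Polytope d′} (G : Aff P → Space d′) →
              (∀ k (w : Vector Carrier k) (p : Vector (Aff P) k) (x : Aff P) → sum w ≈ 1# →
                proj₁ x ≋ combination w (proj₁ ∘ p) → G x ≋ combination w (G ∘ p)) →
              (∀ j → G (Point⇒Aff {P = P} (generator P j)) ∈ Q) → Hom P Q
  affineHom {P = P} {Q} G affine G∈ = record
    { apply        = λ { (x , w , 0≤w , ∑w≈1 , x≋wP) → G (x , w , ∑w≈1 , x≋wP) ,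
        ∈-combination w _ G∈ 0≤w ∑w≈1 (affine _ w _ (x , w , ∑w≈1 , x≋wP) ∑w≈1 x≋wP) }
    ; extension    = λ { (x , w , ∑w≈1 , x≋wP) → G (x , w , ∑w≈1 , x≋wP) ,
        ∈Aff-combination {P = Q} w _ (λ j → proj₂ (Point⇒Aff {P = Q} (_ , G∈ j)))
          ∑w≈1 (affine _ w _ (x , w , ∑w≈1 , x≋wP) ∑w≈1 x≋wP) }
    ; isAffine     = affine
    ; isRestricted = λ _ _ → refl
    }

  -- Generator weights of points of the crosspolytope.

  -e : ∀ {n} → Vector (Space n) n
  -e = map (map (-_)) e

  sum-*-e : ∀ {n} (k : Fin n) (g : Vector Carrier n) → sum (λ i → g i * e i k) ≈ g k
  sum-*-e k g = trans
    (sum-cong-≋ λ i → trans (*-comm (g i) (e i k)) (*-congʳ (reflexive (e-sym i k)))) (sum-e-* k g)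

  combination-◇ : ∀ {n} (w : Vector Carrier (n ℕ.+ n)) i →
                  combination w (generators (◇ n)) i ≈ w (i ↑ˡ n) - w (n ↑ʳ i)
  combination-◇ {n} w i = begin
    combination w (e ++ -e) i
      ≈⟨ sum-split n (λ j → w j * (e ++ -e) j i) ⟩
    sum (λ a → w (a ↑ˡ n) * (e ++ -e) (a ↑ˡ n) i) + sum (λ a → w (n ↑ʳ a) * (e ++ -e) (n ↑ʳ a) i)
      ≈⟨ +-cong
           (sum-cong-≋ λ a → reflexive (≡.cong (λ x → w (a ↑ˡ n) * x i) (lookup-++ˡ e -e a)))
           (sum-cong-≋ λ a → reflexive (≡.cong (λ x → w (n ↑ʳ a) * x i) (lookup-++ʳ e -e a))) ⟩
    sum (λ a → w (a ↑ˡ n) * e a i) + sum (λ a → w (n ↑ʳ a) * - e a i)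
      ≈⟨ +-congˡ (sum-cong-≋ λ a →
           sym (-x*y≈x*-y (w (n ↑ʳ a)) (e a i))) ⟩
    sum (λ a → w (a ↑ˡ n) * e a i) + sum (λ a → - w (n ↑ʳ a) * e a i)
      ≈⟨ +-cong (sum-*-e i (λ a → w (a ↑ˡ n))) (sum-*-e i (λ a → - w (n ↑ʳ a))) ⟩
    w (i ↑ˡ n) - w (n ↑ʳ i) ∎
    where open ≈-Reasoning setoid

  -- Weights of the generators eᵢ and −eᵢ; balance is written without
  -- subtraction to make it a semiring identity.
  record Weights {n} (x : Space n) : Set (c ⊔ ℓ₁ ⊔ ℓ₂) where
    field
      pos neg : Vector Carrier n
      0≤pos   : ∀ i → 0# ≤ pos i
      0≤neg   : ∀ i → 0# ≤ neg i
      total   : sum pos + sum neg ≈ 1#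
      balance : ∀ i → x i + neg i ≈ pos i

  open Weights

  ∈◇⇒Weights : ∀ {n} {x : Space n} → x ∈ ◇ n → Weights x
  ∈◇⇒Weights {n} (w , 0≤w , ∑w≈1 , x≋wP) = record
    { pos     = λ i → w (i ↑ˡ n)
    ; neg     = λ i → w (n ↑ʳ i)
    ; 0≤pos   = λ i → 0≤w (i ↑ˡ n)
    ; 0≤neg   = λ i → 0≤w (n ↑ʳ i)
    ; total   = trans (sym (sum-split n w)) ∑w≈1
    ; balance = λ i → trans (+-congʳ (trans (x≋wP i) (combination-◇ w i))) (//-rightDividesˡ _ _)
    }

  Weights⇒∈◇ : ∀ {n} {x : Space n} → Weights x → x ∈ ◇ n
  Weights⇒∈◇ {n} {x} W = w , 0≤w ,
    trans (sum-split n w) (trans (+-cong (sum-cong-≋ w-left) (sum-cong-≋ w-right)) (total W)) ,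
    λ i → begin
      x i                             ≈⟨ +-cancelʳ (neg W i) _ _ (trans (balance W i) (sym (//-rightDividesˡ _ _))) ⟩
      pos W i - neg W i               ≈⟨ +-cong (w-left i) (-‿cong (w-right i)) ⟨
      w (i ↑ˡ n) - w (n ↑ʳ i)         ≈⟨ combination-◇ w i ⟨
      combination w (generators (◇ n)) i ∎
    where
    open ≈-Reasoning setoid
    w = pos W ++ neg W
    w-left : ∀ i → w (i ↑ˡ n) ≈ pos W i
    w-left i = reflexive (lookup-++ˡ (pos W) (neg W) i)
    w-right : ∀ i → w (n ↑ʳ i) ≈ neg W i
    w-right i = reflexive (lookup-++ʳ (pos W) (neg W) i)
    0≤w : ∀ j → 0# ≤ w j
    0≤w = ↑-elim n (λ j → 0# ≤ w j)
      (λ i → ≤-resp refl (sym (w-left i)) (0≤pos W i))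
      (λ i → ≤-resp refl (sym (w-right i)) (0≤neg W i))

  ∈◇-neg : ∀ {n} {x : Space n} → x ∈ ◇ n → map (-_) x ∈ ◇ n
  ∈◇-neg {x = x} x∈ = Weights⇒∈◇ record
    { pos     = neg W
    ; neg     = pos W
    ; 0≤pos   = 0≤neg W
    ; 0≤neg   = 0≤pos W
    ; total   = trans (+-comm _ _) (total W)
    ; balance = λ i → begin
        - x i + pos W i           ≈⟨ +-congˡ (balance W i) ⟨
        - x i + (x i + neg W i)   ≈⟨ +-assoc _ _ _ ⟨
        (- x i + x i) + neg W i   ≈⟨ +-congʳ (-‿inverseˡ (x i)) ⟩
        0# + neg W i              ≈⟨ +-identityˡ _ ⟩
        neg W i                   ∎
    }
    where
    open ≈-Reasoning setoid
    W = ∈◇⇒Weights x∈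

  e∈◇ : ∀ {n} (k : Fin n) → e k ∈ ◇ n
  e∈◇ {n} k = ≡.subst (_∈ ◇ n) (lookup-++ˡ e -e k) (proj₂ (generator (◇ n) (k ↑ˡ n)))

  -- Escapes of antipodal pairs.

  rescale-∈◇ : ∀ {n} {x A B : Vector Carrier n} → 0# ≤ s → s * (1# - t) ≈ 1# →
               (∀ i → 0# ≤ A i) → (∀ i → 0# ≤ B i) → sum A + sum B ≈ 1# - t →
               (∀ i → x i + B i ≈ A i) → map (s *_) x ∈ ◇ n
  rescale-∈◇ {s = s} {A = A} {B} 0≤s s[1-t]≈1 0≤A 0≤B ∑≈1-t x+B≈A = Weights⇒∈◇ record
    { pos     = map (s *_) A
    ; neg     = map (s *_) B
    ; 0≤pos   = λ i → 0≤* 0≤s (0≤A i)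
    ; 0≤neg   = λ i → 0≤* 0≤s (0≤B i)
    ; total   = begin
        sum (map (s *_) A) + sum (map (s *_) B)   ≈⟨ +-cong (*-distribˡ-sum s A) (*-distribˡ-sum s B) ⟨
        s * sum A + s * sum B                     ≈⟨ distribˡ s _ _ ⟨
        s * (sum A + sum B)                       ≈⟨ *-congˡ ∑≈1-t ⟩
        s * _                                     ≈⟨ s[1-t]≈1 ⟩
        1#                                        ∎
    ; balance = λ i → trans (sym (distribˡ s _ _)) (*-congˡ (x+B≈A i))
    }
    where open ≈-Reasoning setoid

  -- Pushing the antipodal pair (u , v) to s(u + tq) and s(v + tq′), where
  -- s = 1/(1 − t), keeps it in the crosspolytope for all small t > 0.
  record Escape {n} (u v : Space n) : Set (c ⊔ ℓ₁ ⊔ ℓ₂) where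
    field
      q q′       : Space n
      q∈◇        : q ∈ ◇ n
      q′∈◇       : q′ ∈ ◇ n
      q+q′≈0     : ∀ i → q i + q′ i ≈ 0#
      bound      : Carrier
      0<bound    : 0# < bound
      u-escapes  : 0# ≤ s → 0# < t → t ≤ bound → s * (1# - t) ≈ 1# →
                   (λ i → s * (u i + t * q i)) ∈ ◇ n
      v-escapes  : 0# ≤ s → 0# < t → t ≤ bound → s * (1# - t) ≈ 1# →
                   (λ i → s * (v i + t * q′ i)) ∈ ◇ n

  -- Since `q′` is a field tied to `q` by `q+q′≈0`, and not a defined negative, the two halves of an
  -- escape trade places unchanged.
  Escape-swap : ∀ {n} {u v : Space n} → Escape u v → Escape v u
  Escape-swap E = record
    { q∈◇       = q′∈◇
    ; q′∈◇      = q∈◇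
    ; q+q′≈0    = λ i → trans (+-comm _ _) (q+q′≈0 i)
    ; 0<bound   = 0<bound
    ; u-escapes = v-escapes
    ; v-escapes = u-escapes
    }
    where open Escape E

  -- Takes weight `t` off coordinate `k`. The form `t * - e k i` matches the displacement by
  -- `t * q i` when `q` is the negative of `e k`.
  drop : ∀ {n} → Carrier → Fin n → Vector Carrier n → Vector Carrier n
  drop t k w i = w i + t * - e k i

  0≤drop : ∀ {n} (k : Fin n) {w : Vector Carrier n} → (∀ i → 0# ≤ w i) → t ≤ w k →
           ∀ i → 0# ≤ drop t k w i
  0≤drop {t} k {w} 0≤w t≤wk i with k ≟ i
  ... | yes ≡.refl = ≤-resp refl
    (+-congˡ (trans (-‿cong (sym (*-identityʳ t))) (-‿distribʳ-* t 1#))) (≤⇒0≤- t≤wk)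
  ... | no  _      = ≤-resp refl
    (trans (sym (+-identityʳ _)) (+-congˡ (sym (trans (*-congˡ -0#≈0#) (zeroʳ t))))) (0≤w i)

  sum-drop : ∀ {n} t (k : Fin n) (w : Vector Carrier n) → sum (drop t k w) ≈ sum w - t
  sum-drop t k w = begin
    sum (λ i → w i + t * - e k i)         ≈⟨ ∑-distrib-+ w (λ i → t * - e k i) ⟩
    sum w + sum (λ i → t * - e k i)       ≈⟨ +-congˡ (sum-cong-≋ λ i →
                                               sym (-x*y≈x*-y t (e k i))) ⟩
    sum w + sum (λ i → - t * e k i)       ≈⟨ +-congˡ (*-distribˡ-sum (- t) (e k)) ⟨
    sum w + - t * sum (e k)               ≈⟨ +-congˡ (trans (*-congˡ (sum-e k)) (*-identityʳ (- t))) ⟩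
    sum w - t                             ∎
    where open ≈-Reasoning setoid

  module _ {n} {u v : Space n} (U : Weights u) (V : Weights v) (k : Fin n) where

    open ≈-Reasoning setoid

    -- Take q = -eₖ. Then u + tq takes t off the weight of eₖ in u, and v - tq takes t off the
    -- weight of -eₖ in v. Both totals become 1 - t, which `rescale-∈◇` brings back to 1.
    crossing : 0# < pos U k → 0# < neg V k → ¬ ¬ Escape u v
    crossing 0<Uk 0<Vk ¬escape =
      common-lower-bound 0<Uk 0<Vk λ (r , 0<r , r≤Uk , r≤Vk) → ¬escape record
        { q         = λ i → - e k i
        ; q′        = e k
        ; q∈◇       = ∈◇-neg (e∈◇ k)
        ; q′∈◇      = e∈◇ k
        ; q+q′≈0    = λ i → -‿inverseˡ (e k i)
        ; 0<bound   = 0<r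
        ; u-escapes = λ {s} {t} 0≤s _ t≤r s[1-t]≈1 → rescale-∈◇ 0≤s s[1-t]≈1
            (0≤drop k (0≤pos U) (≤-trans t≤r r≤Uk)) (0≤neg U)
            (begin
              sum (drop t k (pos U)) + sum (neg U)   ≈⟨ +-congʳ (sum-drop t k (pos U)) ⟩
              (sum (pos U) - t) + sum (neg U)        ≈⟨ solve 3 (λ a b c → (a :+ b) :+ c := (a :+ c) :+ b) refl _ (- t) _ ⟩
              (sum (pos U) + sum (neg U)) - t        ≈⟨ +-congʳ (total U) ⟩
              1# - t                                 ∎)
            (λ i → begin
              (u i + t * - e k i) + neg U i   ≈⟨ solve 3 (λ a b c → (a :+ b) :+ c := (a :+ c) :+ b) refl _ _ _ ⟩
              (u i + neg U i) + t * - e k i   ≈⟨ +-congʳ (balance U i) ⟩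
              drop t k (pos U) i              ∎)
        ; v-escapes = λ {s} {t} 0≤s _ t≤r s[1-t]≈1 → rescale-∈◇ 0≤s s[1-t]≈1
            (0≤pos V) (0≤drop k (0≤neg V) (≤-trans t≤r r≤Vk))
            (begin
              sum (pos V) + sum (drop t k (neg V))   ≈⟨ +-congˡ (sum-drop t k (neg V)) ⟩
              sum (pos V) + (sum (neg V) - t)        ≈⟨ +-assoc _ _ _ ⟨
              (sum (pos V) + sum (neg V)) - t        ≈⟨ +-congʳ (total V) ⟩
              1# - t                                 ∎)
            (λ i → begin
              (v i + t * e k i) + drop t k (neg V) i
                ≈⟨ solve 5 (λ v t e b e′ → (v :+ t :* e) :+ (b :+ t :* e′) := (v :+ b) :+ t :* (e :+ e′))
                     refl (v i) t (e k i) (neg V i) (- e k i) ⟩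
              (v i + neg V i) + t * (e k i - e k i)
                ≈⟨ +-cong (balance V i) (trans (*-congˡ (-‿inverseʳ _)) (zeroʳ t)) ⟩
              pos V i + 0#
                ≈⟨ +-identityʳ _ ⟩
              pos V i ∎)
        }

    -- Taking t off the weights of both eₖ and -eₖ leaves u in place and frees weight 2t, of which t
    -- pays for adding tv. So q = v works for u; for v itself, v - tv = (1 - t)v rescales to v.
    opposing : 0# < pos U k → 0# < neg U k → ¬ ¬ Escape u v
    opposing 0<pos 0<neg ¬escape =
      common-lower-bound 0<pos 0<neg λ (r , 0<r , r≤pos , r≤neg) → ¬escape record
        { q         = v
        ; q′        = map (-_) v
        ; q∈◇       = Weights⇒∈◇ V
        ; q′∈◇      = ∈◇-neg (Weights⇒∈◇ V)
        ; q+q′≈0    = λ i → -‿inverseʳ (v i)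
        ; 0<bound   = 0<r
        ; u-escapes = λ {s} {t} 0≤s 0<t t≤r s[1-t]≈1 → rescale-∈◇ 0≤s s[1-t]≈1
            (λ i → 0≤+ (0≤drop k (0≤pos U) (≤-trans t≤r r≤pos) i) (0≤* (<-asym 0<t) (0≤pos V i)))
            (λ i → 0≤+ (0≤drop k (0≤neg U) (≤-trans t≤r r≤neg) i) (0≤* (<-asym 0<t) (0≤neg V i)))
            (begin
              sum (λ i → drop t k (pos U) i + t * pos V i) + sum (λ i → drop t k (neg U) i + t * neg V i)
                ≈⟨ +-cong (sum-drop+ t (pos U) (pos V)) (sum-drop+ t (neg U) (neg V)) ⟩
              ((sum (pos U) - t) + t * sum (pos V)) + ((sum (neg U) - t) + t * sum (neg V))
                ≈⟨ solve 6 (λ a b c d t m → ((a :+ m) :+ t :* c) :+ ((b :+ m) :+ t :* d)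
                                           := ((a :+ b) :+ m) :+ (t :* (c :+ d) :+ m))
                     refl (sum (pos U)) (sum (neg U)) (sum (pos V)) (sum (neg V)) t (- t) ⟩
              ((sum (pos U) + sum (neg U)) - t) + (t * (sum (pos V) + sum (neg V)) - t)
                ≈⟨ +-cong (+-congʳ (total U)) (+-congʳ (trans (*-congˡ (total V)) (*-identityʳ t))) ⟩
              (1# - t) + (t - t)
                ≈⟨ trans (+-congˡ (-‿inverseʳ t)) (+-identityʳ _) ⟩
              1# - t ∎)
            (λ i → begin
              (u i + t * v i) + (drop t k (neg U) i + t * neg V i)
                ≈⟨ solve 6 (λ u v b d t m → (u :+ t :* v) :+ ((b :+ t :* m) :+ t :* d)
                                           := ((u :+ b) :+ t :* m) :+ t :* (v :+ d))
                     refl (u i) (v i) (neg U i) (neg V i) t (- e k i) ⟩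
              ((u i + neg U i) + t * - e k i) + t * (v i + neg V i)
                ≈⟨ +-cong (+-congʳ (balance U i)) (*-congˡ (balance V i)) ⟩
              drop t k (pos U) i + t * pos V i ∎)
        ; v-escapes = λ {s} {t} _ _ _ s[1-t]≈1 → ∈-resp-≋
            (λ i → begin
              v i                        ≈⟨ trans (*-congʳ s[1-t]≈1) (*-identityˡ _) ⟨
              (s * (1# - t)) * v i       ≈⟨ solve 4 (λ s o m v → (s :* (o :+ m)) :* v := s :* (o :* v :+ m :* v))
                                              refl s 1# (- t) (v i) ⟩
              s * (1# * v i + - t * v i) ≈⟨ *-congˡ (+-cong (*-identityˡ _)
                                              (-x*y≈x*-y t (v i))) ⟩
              s * (v i + t * - v i)      ∎)
            (Weights⇒∈◇ V)
        }
      where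
      sum-drop+ : ∀ t w w′ → sum (λ i → drop t k w i + t * w′ i) ≈ (sum w - t) + t * sum w′
      sum-drop+ t w w′ = trans (∑-distrib-+ (drop t k w) (λ i → t * w′ i))
        (+-cong (sum-drop t k w) (sym (*-distribˡ-sum t w′)))

  -- Signs and facets of the crosspolytope.

  IsSign : Carrier → Set ℓ₁
  IsSign σ = σ ≈ 1# ⊎ σ ≈ - 1#

  -- With `p` the weight of eₖ and `r` that of -eₖ, all weight lies on the side of `σ`. Both signs
  -- qualify if both weights vanish.
  Signs : Carrier → Carrier → Carrier → Set ℓ₁
  Signs σ p r = σ ≈ 1# × r ≈ 0# ⊎ σ ≈ - 1# × p ≈ 0#

  Signs⇒IsSign : ∀ {σ p r} → Signs σ p r → IsSign σ
  Signs⇒IsSign = Sum.map proj₁ proj₁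

  sign-square : ∀ {σ} → IsSign σ → σ * σ ≈ 1#
  sign-square (inj₁ σ≈1)  = trans (*-cong σ≈1 σ≈1) (*-identityˡ 1#)
  sign-square (inj₂ σ≈-1) = trans (*-cong σ≈-1 σ≈-1) (trans (-1*x≈-x (- 1#)) (-‿involutive 1#))

  signed-value : ∀ {σ x p r} → x + r ≈ p → Signs σ p r → σ * x ≈ p + r
  signed-value {σ} {x} {p} {r} x+r≈p (inj₁ (σ≈1 , r≈0)) = begin
    σ * x    ≈⟨ trans (*-congʳ σ≈1) (*-identityˡ x) ⟩
    x        ≈⟨ +-identityʳ x ⟨
    x + 0#   ≈⟨ +-congˡ r≈0 ⟨
    x + r    ≈⟨ x+r≈p ⟩
    p        ≈⟨ +-identityʳ p ⟨
    p + 0#   ≈⟨ +-congˡ r≈0 ⟨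
    p + r    ∎
    where open ≈-Reasoning setoid
  signed-value {σ} {x} {p} {r} x+r≈p (inj₂ (σ≈-1 , p≈0)) = begin
    σ * x    ≈⟨ trans (*-congʳ σ≈-1) (-1*x≈-x x) ⟩
    - x      ≈⟨ +-inverseˡ-unique _ _ (trans (+-comm r x) (trans x+r≈p p≈0)) ⟨
    r        ≈⟨ +-identityˡ r ⟨
    0# + r   ≈⟨ +-congʳ p≈0 ⟨
    p + r    ∎
    where open ≈-Reasoning setoid

  x≤x+y+y : ∀ x → 0# ≤ y → x ≤ (x + y) + y
  x≤x+y+y x 0≤y = ≤-resp (trans (+-identityʳ _) (+-identityʳ x)) refl
    (+-mono-≤ (+-mono-≤ (≤-reflexive refl) 0≤y) 0≤y)

  -- As x + r = p, the sum p + r exceeds x by 2r and -x by 2p.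
  signed-bound : ∀ {σ x p r} → 0# ≤ p → 0# ≤ r → x + r ≈ p → IsSign σ → σ * x ≤ p + r
  signed-bound {σ} {x} {p} {r} 0≤p 0≤r x+r≈p (inj₁ σ≈1) = ≤-resp
    (sym (trans (*-congʳ σ≈1) (*-identityˡ x))) (+-congʳ x+r≈p) (x≤x+y+y x 0≤r)
  signed-bound {σ} {x} {p} {r} 0≤p 0≤r x+r≈p (inj₂ σ≈-1) = ≤-resp
    (sym (trans (*-congʳ σ≈-1) (-1*x≈-x x))) -x+p+p≈p+r (x≤x+y+y (- x) 0≤p)
    where
    open ≈-Reasoning setoid
    -x+p+p≈p+r : (- x + p) + p ≈ p + r
    -x+p+p≈p+r = begin
      (- x + p) + p         ≈⟨ +-congʳ (+-congˡ x+r≈p) ⟨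
      (- x + (x + r)) + p   ≈⟨ solve 4 (λ m x r p → (m :+ (x :+ r)) :+ p := (m :+ x) :+ (p :+ r))
                                 refl (- x) x r p ⟩
      (- x + x) + (p + r)   ≈⟨ trans (+-congʳ (-‿inverseˡ x)) (+-identityˡ _) ⟩
      p + r                 ∎

  -- Nothing cancels when each coordinate uses only the side of its sign, so the signed sum is the
  -- total weight: `x` lies on the facet with normal `σ`.
  sum-signed : ∀ {n} {x : Space n} {σ : Vector Carrier n} (W : Weights x) →
               (∀ k → Signs (σ k) (pos W k) (neg W k)) → sum (λ k → σ k * x k) ≈ 1#
  sum-signed W signs = trans
    (sum-cong-≋ λ k → signed-value (balance W k) (signs k))
    (trans (∑-distrib-+ (pos W) (neg W)) (total W))

  sum-signed-≤ : ∀ {n} {x : Space n} {σ : Vector Carrier n} (W : Weights x) →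
                 (∀ k → IsSign (σ k)) → sum (λ k → σ k * x k) ≤ 1#
  sum-signed-≤ W sign = ≤-resp refl
    (trans (∑-distrib-+ (pos W) (neg W)) (total W))
    (sum-mono-≤ λ k → signed-bound (0≤pos W k) (0≤neg W k) (balance W k) (sign k))

  -- Shifting the first coordinate of `b` by η in the direction of its sign raises the signed sum by
  -- exactly η, and the shifted point still satisfies the facet inequality.
  interior-signed : ∀ {n} {b : Space (suc n)} {σ : Vector Carrier (suc n)} →
                    b ∈Interior ◇ (suc n) → (∀ k → IsSign (σ k)) →
                    ∃ λ η → 0# < η × sum (λ k → σ k * b k) + η ≤ 1#
  interior-signed {n} {b} {σ} (ε , 0<ε , ball) sign =
    η , 0<η , ≤-resp σb′≈σb+η refl (sum-signed-≤ (∈◇⇒Weights (ball b′ near)) sign)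
    where
    open ≈-Reasoning setoid

    h η : Carrier
    h = proj₁ half
    -- Halving `ε` makes the shift strictly shorter than the radius of the open ball.
    η = ε * h

    b′ : Space (suc n)
    b′ = (b zero + η * σ zero) ∷ (b ∘ suc)

    0<η : 0# < η
    0<η = *-pos 0<ε 0<half

    η<ε : η < ε
    η<ε = <-resp (+-identityʳ η)
      (trans (sym (distribˡ ε h h)) (trans (*-congˡ (proj₁ (proj₂ half))) (*-identityʳ ε)))
      (+-monoʳ-< η 0<η)

    b′₀-b₀ : b′ zero - b zero ≈ η * σ zero
    b′₀-b₀ = xyx⁻¹≈y (b zero) (η * σ zero)

    near : sum (λ i → (b′ i - b i) * (b′ i - b i)) < ε * ε
    near = <-respˡ-≈ (sym (begin
      sum (λ i → (b′ i - b i) * (b′ i - b i))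
        ≈⟨ +-cong (*-cong b′₀-b₀ b′₀-b₀)
             (sum-zero λ i → trans (*-congʳ (-‿inverseʳ (b (suc i)))) (zeroˡ _)) ⟩
      (η * σ zero) * (η * σ zero) + 0#
        ≈⟨ trans (+-identityʳ _) (solve 2 (λ η σ → (η :* σ) :* (η :* σ) := (η :* η) :* (σ :* σ)) refl η (σ zero)) ⟩
      (η * η) * (σ zero * σ zero)
        ≈⟨ trans (*-congˡ (sign-square (sign zero))) (*-identityʳ _) ⟩
      η * η ∎)) (square-mono-< 0<η η<ε)

    σb′≈σb+η : sum (λ k → σ k * b′ k) ≈ sum (λ k → σ k * b k) + η
    σb′≈σb+η = begin
      σ zero * (b zero + η * σ zero) + rest
        ≈⟨ solve 4 (λ σ b η r → σ :* (b :+ η :* σ) :+ r := (σ :* b :+ r) :+ η :* (σ :* σ))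
             refl (σ zero) (b zero) η rest ⟩
      (σ zero * b zero + rest) + η * (σ zero * σ zero)
        ≈⟨ +-congˡ (trans (*-congˡ (sign-square (sign zero))) (*-identityʳ η)) ⟩
      sum (λ k → σ k * b k) + η ∎
      where rest = sum (λ k → σ (suc k) * b (suc k))

  -- If no escape existed, each coordinate would carry weight of one sign only,
  -- the same for u and v, so that a signed coordinate sum is 1 at both and hence
  -- at their midpoint b, which would then lie on the boundary.
  ¬¬-Escape : ∀ {n} {b u v : Space (suc n)} → b ∈Interior ◇ (suc n) →
              u ∈ ◇ (suc n) → v ∈ ◇ (suc n) → (∀ i → b i + b i ≈ u i + v i) →
              ¬ ¬ Escape u v
  ¬¬-Escape {n} {b} {u} {v} b∈ u∈ v∈ 2b≈u+v ¬escape = ¬¬-sequence ¬¬signs λ signs →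
    let σ = λ k → proj₁ (signs k)
        η , 0<η , σb+η≤1 = interior-signed {b = b} b∈ (λ k → Signs⇒IsSign (proj₁ (proj₂ (signs k))))
        ∑ : Space (suc n) → Carrier
        ∑ x = sum (λ k → σ k * x k)
        2σb≈2 : ∑ b + ∑ b ≈ 1# + 1#
        2σb≈2 = begin
          ∑ b + ∑ b                               ≈⟨ ∑-distrib-+ (λ k → σ k * b k) (λ k → σ k * b k) ⟨
          sum (λ k → σ k * b k + σ k * b k)       ≈⟨ sum-cong-≋ (λ k → trans (sym (distribˡ (σ k) _ _))
                                                       (trans (*-congˡ (2b≈u+v k)) (distribˡ (σ k) _ _))) ⟩
          sum (λ k → σ k * u k + σ k * v k)       ≈⟨ ∑-distrib-+ (λ k → σ k * u k) (λ k → σ k * v k) ⟩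
          ∑ u + ∑ v                               ≈⟨ +-cong (sum-signed U λ k → proj₁ (proj₂ (signs k)))
                                                            (sum-signed V λ k → proj₂ (proj₂ (signs k))) ⟩
          1# + 1#                                 ∎
    -- Doubling the inequality at b bounds 2∑b + 2η by 2, although 2∑b is already 2 and η is
    -- positive.
    in +-mono-≤ σb+η≤1 σb+η≤1 (<-resp (trans (+-identityʳ _) 2σb≈2)
         (solve 2 (λ s η → (s :+ s) :+ (η :+ η) := (s :+ η) :+ (s :+ η)) refl (∑ b) η)
         (+-monoʳ-< (∑ b + ∑ b) (<-trans 0<η (<-respˡ-≈ (+-identityʳ η) (+-monoʳ-< η 0<η)))))
    where
    open ≈-Reasoning setoid

    U = ∈◇⇒Weights u∈
    V = ∈◇⇒Weights v∈

    Signed : Fin (suc n) → Set (c ⊔ ℓ₁)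
    Signed k = ∃ λ σ → Signs σ (pos U k) (neg U k) × Signs σ (pos V k) (neg V k)

    ¬¬signs : ∀ k → ¬ ¬ Signed k
    -- Without an escape, weight on eₖ in one of the points excludes weight on -eₖ in the same point
    -- by `opposing` and in the other by `crossing`. If neither has weight on eₖ, the sign -1 serves
    -- both.
    ¬¬signs k ¬signs = ¬¬-excluded-middle {A = 0# < pos U k ⊎ 0# < pos V k} λ where
      (yes (inj₁ 0<posU)) → ¬signs (1# ,
        inj₁ (refl , ≤-antisym (λ 0<negU → opposing U V k 0<posU 0<negU ¬escape) (0≤neg U k)) ,
        inj₁ (refl , ≤-antisym (λ 0<negV → crossing U V k 0<posU 0<negV ¬escape) (0≤neg V k)))
      (yes (inj₂ 0<posV)) → ¬signs (1# ,
        inj₁ (refl , ≤-antisym (λ 0<negU → crossing V U k 0<posV 0<negU (¬escape ∘ Escape-swap)) (0≤neg U k)) ,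
        inj₁ (refl , ≤-antisym (λ 0<negV → opposing V U k 0<posV 0<negV (¬escape ∘ Escape-swap)) (0≤neg V k)))
      (no ¬0<pos) → ¬signs (- 1# ,
        inj₂ (refl , ≤-antisym (¬0<pos ∘ inj₁) (0≤pos U k)) ,
        inj₂ (refl , ≤-antisym (¬0<pos ∘ inj₂) (0≤pos V k)))

  -- Linear maps given by antipodal values.

  module _ {m d} {q q′ : Vector (Space d) m} (q+q′≈0 : ∀ j i → q j i + q′ j i ≈ 0#) where

    combination-eˡ : ∀ j → combination (generators (◇ m) (j ↑ˡ m)) q ≋ q j
    combination-eˡ j i = trans
      (reflexive (≡.cong (λ x → combination x q i) (lookup-++ˡ e -e j))) (combination-e j q i)

    combination-eʳ : ∀ j → combination (generators (◇ m) (m ↑ʳ j)) q ≋ q′ j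
    combination-eʳ j i = begin
      combination (generators (◇ m) (m ↑ʳ j)) q i
        ≈⟨ reflexive (≡.cong (λ x → combination x q i) (lookup-++ʳ e -e j)) ⟩
      sum (λ k → - e j k * q k i)
        ≈⟨ sum-cong-≋ (λ k → -x*y≈x*-y (e j k) (q k i)) ⟩
      sum (λ k → e j k * - q k i)
        ≈⟨ combination-e j (map (map (-_)) q) i ⟩
      - q j i
        ≈⟨ +-inverseˡ-unique _ _ (trans (+-comm _ _) (q+q′≈0 j i)) ⟨
      q′ j i ∎
      where open ≈-Reasoning setoid

    combination-opposite : ∀ x i → combination x q i + combination x q′ i ≈ 0#
    combination-opposite x i = trans (sym (combination-+ x q q′ i))
      (sum-zero λ j → trans (*-congˡ (q+q′≈0 j i)) (zeroʳ (x j)))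

  -- Decomposing a homomorphism along its escapes.

  module _ {m n} (1≤m : 1 ≤ℕ m) (f : Hom (◇ m) (◇ n)) where

    open Hom f using (extension; isAffine; isRestricted)

    f⁺ f⁻ : Vector (Point (◇ n)) m
    f⁺ j = Hom.apply f (generator (◇ m) (j ↑ˡ m))
    f⁻ j = Hom.apply f (generator (◇ m) (m ↑ʳ j))

    -- The origin is the midpoint of eⱼ and -eⱼ, and the affine extension preserves midpoints.
    f-midpoint : ∀ j i → (f ⟨ origin 1≤m ⟩) i + (f ⟨ origin 1≤m ⟩) i ≈ proj₁ (f⁺ j) i + proj₁ (f⁻ j) i
    f-midpoint j i = begin
      b + b                               ≈⟨ +-cong b≈ b≈ ⟩
      (h * u + (h * v + 0#)) + (h * u + (h * v + 0#))
        ≈⟨ +-cong (+-congˡ (+-identityʳ _)) (+-congˡ (+-identityʳ _)) ⟩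
      (h * u + h * v) + (h * u + h * v)
        ≈⟨ solve 3 (λ h u v → (h :* u :+ h :* v) :+ (h :* u :+ h :* v) := (h :+ h) :* (u :+ v)) refl h u v ⟩
      (h + h) * (u + v)                   ≈⟨ trans (*-congʳ h+h≈1) (*-identityˡ _) ⟩
      u + v                               ≈⟨ +-cong (isRestricted (generator (◇ m) (j ↑ˡ m)) i)
                                                    (isRestricted (generator (◇ m) (m ↑ʳ j)) i) ⟨
      proj₁ (f⁺ j) i + proj₁ (f⁻ j) i     ∎
      where
      open ≈-Reasoning setoid
      h = proj₁ half
      h+h≈1 = proj₁ (proj₂ half)
      b = (f ⟨ origin 1≤m ⟩) i

      a⁺ a⁻ : Aff (◇ m)
      a⁺ = Point⇒Aff {P = ◇ m} (generator (◇ m) (j ↑ˡ m))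
      a⁻ = Point⇒Aff {P = ◇ m} (generator (◇ m) (m ↑ʳ j))

      u = proj₁ (extension a⁺) i
      v = proj₁ (extension a⁻) i

      0≈ : 𝟎 ≋ combination (h ∷ h ∷ []) (proj₁ ∘ (a⁺ ∷ a⁻ ∷ []))
      0≈ k = sym (begin
        h * proj₁ a⁺ k + (h * proj₁ a⁻ k + 0#)
          ≈⟨ +-cong (*-congˡ (reflexive (≡.cong (λ x → x k) (lookup-++ˡ e -e j))))
                    (trans (+-identityʳ _) (*-congˡ (reflexive (≡.cong (λ x → x k) (lookup-++ʳ e -e j))))) ⟩
        h * e j k + h * - e j k   ≈⟨ distribˡ h _ _ ⟨
        h * (e j k - e j k)       ≈⟨ trans (*-congˡ (-‿inverseʳ _)) (zeroʳ h) ⟩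
        0#                        ∎)

      b≈ : b ≈ h * u + (h * v + 0#)
      b≈ = trans (isRestricted (origin 1≤m) i)
        (isAffine 2 (h ∷ h ∷ []) (a⁺ ∷ a⁻ ∷ []) (Point⇒Aff {P = ◇ m} (origin 1≤m))
          (trans (+-congˡ (+-identityʳ h)) h+h≈1) 0≈ i)

    module _ (E : ∀ j → Escape (proj₁ (f⁺ j)) (proj₁ (f⁻ j)))
             {t} (0<t : 0# < t) (t<1 : t < 1#) (t≤bound : ∀ j → t ≤ Escape.bound (E j)) where

      open module E j = Escape (E j) using (q; q′; q+q′≈0)

      linear : Hom (◇ m) (◇ n)
      linear = affineHom (λ x → combination (proj₁ x) q′)
        (λ k w p x _ x≋wp i → trans (combination-congˡ q′ x≋wp i) (combination-assoc w (proj₁ ∘ p) q′ i))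
        -- The roles of `q` and `q′` are exchanged: eⱼ goes to `q′ j` and -eⱼ to `q j`.
        (↑-elim m (λ l → combination (generators (◇ m) l) q′ ∈ ◇ n)
          (λ j → ∈-resp-≋ (λ i → sym (combination-eˡ q′+q≈0 j i)) (Escape.q′∈◇ (E j)))
          (λ j → ∈-resp-≋ (λ i → sym (combination-eʳ q′+q≈0 j i)) (Escape.q∈◇ (E j))))
        where
        q′+q≈0 : ∀ j i → q′ j i + q j i ≈ 0#
        q′+q≈0 j i = trans (+-comm _ _) (q+q′≈0 j i)

      r = proj₁ (inverse-1-t t<1)
      0≤r = proj₁ (proj₂ (inverse-1-t t<1))
      r[1-t]≈1 = proj₂ (proj₂ (inverse-1-t t<1))

      -- This is (f + tC)/(1 - t), where C is linear with eⱼ ↦ qⱼ. Its values at ±eⱼ are exactly the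
      -- points that `u-escapes` and `v-escapes` place in the crosspolytope. It uses `extension`
      -- because it has to be defined on the affine hull.
      pushed : Hom (◇ m) (◇ n)
      pushed = affineHom G G-affine
        (↑-elim m (λ l → G (Point⇒Aff {P = ◇ m} (generator (◇ m) l)) ∈ ◇ n)
          (λ j → ∈-resp-≋
            (λ i → *-congˡ (+-cong (isRestricted (generator (◇ m) (j ↑ˡ m)) i)
                                   (*-congˡ (sym (combination-eˡ q+q′≈0 j i)))))
            (Escape.u-escapes (E j) 0≤r 0<t (t≤bound j) r[1-t]≈1))
          (λ j → ∈-resp-≋
            (λ i → *-congˡ (+-cong (isRestricted (generator (◇ m) (m ↑ʳ j)) i)
                                   (*-congˡ (sym (combination-eʳ q+q′≈0 j i)))))
            (Escape.v-escapes (E j) 0≤r 0<t (t≤bound j) r[1-t]≈1)))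
        where
        F : Aff (◇ m) → Space n
        F x = proj₁ (extension x)

        C : Aff (◇ m) → Space n
        C x = combination (proj₁ x) q

        G : Aff (◇ m) → Space n
        G x i = r * (F x i + t * C x i)

        G-affine : ∀ k (w : Vector Carrier k) (p : Vector (Aff (◇ m)) k) (x : Aff (◇ m)) → sum w ≈ 1# →
                   proj₁ x ≋ combination w (proj₁ ∘ p) → G x ≋ combination w (G ∘ p)
        G-affine k w p x ∑w≈1 x≋wp i = begin
          r * (F x i + t * C x i)
            ≈⟨ *-congˡ (+-cong (isAffine k w p x ∑w≈1 x≋wp i)
                 (*-congˡ (trans (combination-congˡ q x≋wp i) (combination-assoc w (proj₁ ∘ p) q i)))) ⟩
          r * (combination w (F ∘ p) i + t * combination w (C ∘ p) i)
            ≈⟨ *-congˡ (+-congˡ (combination-* t w (C ∘ p) i)) ⟨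
          r * (combination w (F ∘ p) i + combination w (λ j i → t * C (p j) i) i)
            ≈⟨ *-congˡ (combination-+ w (F ∘ p) (λ j i → t * C (p j) i) i) ⟨
          r * combination w (λ j i → F (p j) i + t * C (p j) i) i
            ≈⟨ combination-* r w (λ j i → F (p j) i + t * C (p j) i) i ⟨
          combination w (G ∘ p) i ∎
          where open ≈-Reasoning setoid

      f≈pushed+linear : ∀ x i → (f ⟨ x ⟩) i ≈ (1# - t) * (pushed ⟨ x ⟩) i + t * (linear ⟨ x ⟩) i
      f≈pushed+linear x i = sym (begin
        (1# - t) * (r * (a + t * b)) + t * d
          ≈⟨ solve 6 (λ o r t a b d → o :* (r :* (a :+ t :* b)) :+ t :* d
                                      := (r :* o) :* (a :+ t :* b) :+ t :* d)
               refl (1# - t) r t a b d ⟩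
        (r * (1# - t)) * (a + t * b) + t * d
          ≈⟨ +-congʳ (trans (*-congʳ r[1-t]≈1) (*-identityˡ _)) ⟩
        (a + t * b) + t * d
          ≈⟨ solve 4 (λ t a b d → (a :+ t :* b) :+ t :* d := a :+ t :* (b :+ d)) refl t a b d ⟩
        a + t * (b + d)
          ≈⟨ +-congˡ (trans (*-congˡ (combination-opposite q+q′≈0 (proj₁ x) i)) (zeroʳ t)) ⟩
        a + 0#
          ≈⟨ trans (+-identityʳ a) (sym (isRestricted x i)) ⟩
        (f ⟨ x ⟩) i ∎)
        where
        open ≈-Reasoning setoid
        a = proj₁ (extension (Point⇒Aff {P = ◇ m} x)) i
        b = combination (proj₁ x) q i
        d = combination (proj₁ x) q′ i

      -- Extremality identifies `f` with `linear`, which vanishes at the origin.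
      vertex⇒origin-fixed : IsVertex f → f ⟨ origin 1≤m ⟩ ≋ 𝟎
      vertex⇒origin-fixed vertex i = trans
        (proj₂ (vertex pushed linear t 0<t t<1 f≈pushed+linear) (origin 1≤m) i)
        (sum-zero λ j → zeroˡ (q′ j i))

open Crosspolytopes

theorem6p1 : ∀ {c ℓ₁ ℓ₂} (ℝ : RealNumbers c ℓ₁ ℓ₂) → let open Polytopes ℝ in
    ∀ (m n : ℕ) (2≤m : 2 ≤ℕ m) (2≤n : 2 ≤ℕ n) (f : Hom (◇ m) (◇ n)) →
    IsVertex f →
    f ⟨ origin (<⇒≤ 2≤m) ⟩ ∈Interior ◇ n →
    f ⟨ origin (<⇒≤ 2≤m) ⟩ ≋ 𝟎
theorem6p1 ℝ m n@(suc _) 2≤m 2≤n f vertex b∈ i =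
  -- By tightness it is enough to refute apartness from 0. With falsity as the goal, the doubly
  -- negated choices of escapes and of `t` can be opened.
  proj₁ (tight _ _) λ b#0 →
  ¬¬-sequence (λ j → ¬¬-Escape ℝ b∈ (proj₂ (f⁺ ℝ 1≤m f j)) (proj₂ (f⁻ ℝ 1≤m f j)) (f-midpoint ℝ 1≤m f j)) λ E →
  -- Putting one half in front of the escape bounds forces t < 1.
  lower-bound ℝ (proj₁ half ∷ λ j → Escape.bound (E j))
    (λ where
      zero    → 0<half ℝ
      (suc j) → Escape.0<bound (E j))
    λ (t , 0<t , t≤) →
  proj₂ (tight _ _)
    (vertex⇒origin-fixed ℝ 1≤m f E 0<t (≤-<-trans ℝ (t≤ zero) (half<1 ℝ)) (t≤ ∘ suc) vertex i) b#0
  where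
  open Polytopes ℝ using (half; tight)
  1≤m = <⇒≤ 2≤m
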